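{- Let $\mathcal{L}$ be a compendious logic. For every encoding $(\Sigma_C,f)$, the image of $f$ is a proper subset of $\Theta_{\mathcal{L}}$; i.e., no encoding represents every theory of $\mathcal{L}$.
   Context: A logic is a pair $\mathcal{L}=(\mathrm{Fm},\mathrm{Cn})$ with a countable set $\mathrm{Fm}$ and $\mathrm{Cn}:\mathcal{P}(\mathrm{Fm})\to\mathcal{P}(\mathrm{Fm})$; Tarskian means $\mathrm{Cn}$ is monotone, extensive and idempotent. Boolean means for all $\varphi,\psi$ there are formulae $\neg\varphi,\varphi\lor\psi$ with $\mathrm{Cn}(\{\varphi\})\cap\mathrm{Cn}(\{\neg\varphi\})=\mathrm{Cn}(\emptyset)$, $\mathrm{Cn}(\{\varphi,\neg\varphi\})=\mathrm{Fm}$, ($\varphi\in\mathrm{Cn}(X)\Rightarrow\varphi\lor\psi\in\mathrm{Cn}(X)$), and ($\alpha\in\mathrm{Cn}(X\cup\{\varphi\})$ and $\alpha\in\mathrm{Cn}(X\cup\{\psi\})$ imply $\alpha\in\mathrm{Cn}(X\cup\{\varphi\lor\psi\})$). A theory is $K$ with $\mathrm{Cn}(K)=K$; $\Theta_{\mathcal{L}}$ is the set of theories; non-finitary means $\Theta_{\mathcal L}$ is infinite. $\mathrm{CCT}$ is the set of complete ($\varphi\in K$ or $\neg\varphi\in K$ for all $\varphi$) consistent ($K\ne\mathrm{Fm}$) theories. (Discerning): for all $X,Y\subseteq\mathrm{CCT}$, $\bigcap X=\bigcap Y$ implies $X=Y$. Compendious = Tarskian, Boolean, non-finitary and Discerning.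 An encoding is a finite alphabet $\Sigma_C$ with a partial function $f:\Sigma_C^*\rightharpoonup\Theta_{\mathcal{L}}$.
   Formalization: In the definition of Boolean, disjunction introduction is required for both disjuncts (also ψ∈Cn(X) implies φ∨ψ∈Cn(X)); with the one-sided rule alone, φ∨ψ=φ would qualify and the claim would be false. -}

module Defs where

open import Data.List.Base using (List)
open import Data.List.Relation.Unary.Enumerates.Setoid using (IsEnumeration)
open import Data.Maybe.Base using (Maybe)
open import Data.Maybe.Relation.Unary.Any using (Any)
open import Data.Nat.Base using (ℕ)
open import Data.Product.Base using (Σ; ∃-syntax; proj₁)
open import Data.Sum.Base using (_⊎_)
open import Function.Bundles using (_↣_)
open import Level using (0ℓ; suc; _⊔_)
open import Relation.Binary.Bundles using (Setoid)
open import Relation.Binary.Construct.On as On using ()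
open import Relation.Binary.Definitions using (_Respects_)
open import Relation.Binary.PropositionalEquality using (setoid)
open import Relation.Nullary using (¬_)
open import Relation.Unary
  using (Pred; _∈_; _⊆_; _≐_; _∩_; _∪_; ∅; U; ｛_｝; ⋂)
open import Relation.Unary.Relation.Binary.Equality using (≐-setoid)

Finite : ∀ {a ℓ} → Setoid a ℓ → Set (a ⊔ ℓ)
Finite S = ∃[ xs ] IsEnumeration S xs

-- Sets of formulae are predicates, compared by _≐_ (mutual inclusion);
-- Cn-cong says that Cn is a function with respect to this equality.
record Logic : Set₁ where
  field
    Fm        : Set
    countable : Fm ↣ ℕ
    Cn        : Pred Fm 0ℓ → Pred Fm 0ℓ
    Cn-cong   : ∀ {X Y} → X ≐ Y → Cn X ≐ Cn Y

module _ (L : Logic) where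
  open Logic L

  record Tarskian : Set₁ where
    field
      monotone   : ∀ {X Y} → X ⊆ Y → Cn X ⊆ Cn Y
      extensive  : ∀ X → X ⊆ Cn X
      idempotent : ∀ X → Cn (Cn X) ≐ Cn X

  -- Disjunction introduction is required for both disjuncts: with
  -- ∨-introˡ alone, φ ∨ ψ = φ would qualify as a disjunction.
  record Boolean : Set₁ where
    infix  8 ~_
    infixr 7 _∨_
    field
      ~_       : Fm → Fm
      _∨_      : Fm → Fm → Fm
      ~-meet   : ∀ φ → Cn ｛ φ ｝ ∩ Cn ｛ ~ φ ｝ ≐ Cn ∅
      ~-join   : ∀ φ → Cn (｛ φ ｝ ∪ ｛ ~ φ ｝) ≐ U
      ∨-introˡ : ∀ X φ ψ → φ ∈ Cn X → φ ∨ ψ ∈ Cn X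
      ∨-introʳ : ∀ X φ ψ → ψ ∈ Cn X → φ ∨ ψ ∈ Cn X
      ∨-elim   : ∀ X φ ψ α → α ∈ Cn (X ∪ ｛ φ ｝) → α ∈ Cn (X ∪ ｛ ψ ｝) →
                 α ∈ Cn (X ∪ ｛ φ ∨ ψ ｝)

  record Theory : Set₁ where
    field
      carrier : Pred Fm 0ℓ
      closed  : Cn carrier ≐ carrier

  open Theory

  Θ : Setoid (suc 0ℓ) 0ℓ
  Θ = On.setoid (≐-setoid Fm 0ℓ) carrier

  open Setoid Θ using (_≈_)

  NonFinitary : Set₁
  NonFinitary = ¬ Finite Θ

  Consistent : Pred Theory 0ℓ
  Consistent K = ¬ (carrier K ≐ U)

  module _ (B : Boolean) where
    open Boolean B

    Complete : Pred Theory 0ℓ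
    Complete K = ∀ φ → φ ∈ carrier K ⊎ ~ φ ∈ carrier K

    CCT : Pred Theory 0ℓ
    CCT = Complete ∩ Consistent

    -- A set of complete consistent theories, i.e. a predicate invariant
    -- under equality of theories.
    record SubsetOfCCT : Set₁ where
      field
        members     : Pred Theory 0ℓ
        extensional : members Respects _≈_
        included    : members ⊆ CCT

    open SubsetOfCCT

    -- The intersection of the empty set is Fm.
    Intersection : SubsetOfCCT → Pred Fm (suc 0ℓ)
    Intersection X = ⋂[ K ∶ Σ Theory (members X) ] carrier (proj₁ K)

    Discerning : Set₁
    Discerning = ∀ X Y → Intersection X ≐ Intersection Y →
                 members X ≐ members Y

  record Compendious : Set₁ where
    field
      tarskian    : Tarskian
      boolean     : Boolean
      nonFinitary : NonFinitary
      discerning  : Discerning boolean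

  record Encoding : Set₁ where
    field
      Alphabet       : Set
      alphabetFinite : Finite (setoid Alphabet)
      decode         : List Alphabet → Maybe Theory

  Image : Encoding → Pred Theory (suc 0ℓ)
  Image E K = ∃[ w ] Any (_≈ K) (decode w)
    where open Encoding E

-- The theories of a Boolean Tarskian logic are determined by the formulae they
-- contain up to interderivability, so if there are infinitely many theories
-- then the Lindenbaum algebra is infinite.  Call a formula large when
-- infinitely many classes lie below it.  A large b has a large b′ strictly
-- below it: split b by some c strictly between ⊥ and b; one of b ∧ c, b ∧ ¬c is
-- large again.  Iterating from ⊤ gives b₀ > b₁ > ….  The formulae
-- eₙ = (bₙ → bₙ₊₁) are independent: bₙ ∧ ¬bₙ₊₁ is consistent, refutes eₙ and
-- entails every other eᵢ.  Hence the theories generated by subsets of {eₙ} are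
-- pairwise distinct, and there are only countably many words, so Cantor's
-- diagonal set of the e's generates a theory that no word represents.
module Submission where

open import Defs
open import Axiom.ExcludedMiddle using (ExcludedMiddle)
open import Axiom.DoubleNegationElimination using (em⇒dne)
open import Data.Fin.Base using (Fin; toℕ)
open import Data.Fin.Properties using (toℕ-injective; toℕ<n; nonZeroIndex)
open import Data.List.Base
  using (List; []; _∷_; [_]; _++_; map; length; cartesianProductWith)
import Data.List.Membership.Propositional as List
import Data.List.Membership.Setoid.Properties as Membership
open import Data.List.Relation.Unary.Any as Any using (Any; here; there)
open import Data.List.Relation.Unary.Any.Properties
  using (++⁺ˡ; ++⁺ʳ; map⁺; cartesianProductWith⁺)
open import Data.Maybe.Base using (Maybe; just; maybe′)
import Data.Maybe.Relation.Unary.Any as Maybe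
open import Data.Nat.Base using (ℕ; _+_; _*_; _≤′_; ≤′-refl; ≤′-step)
open import Data.Nat.DivMod using (_%_; [m+kn]%n≡m%n; m<n⇒m%n≡m)
open import Data.Nat.Properties
  using (<-cmp; ≤⇒≤′; suc-injective; +-cancelˡ-≡; *-cancelʳ-≡)
open import Data.Product.Base using (Σ; ∃-syntax; _×_; _,_; proj₁; proj₂; map₂)
open import Data.Sum.Base using (_⊎_; inj₁; inj₂; [_,_]′)
open import Data.Unit.Base using (tt)
open import Function.Base using (_∘_)
open import Function.Definitions using (Injective)
open import Level using (0ℓ; suc; lift; lower)
open import Relation.Binary.Definitions using (tri<; tri≈; tri>)
open import Relation.Binary.PropositionalEquality
  using (_≡_; _≢_; refl; sym; trans; cong; cong₂; subst; setoid)
open import Relation.Nullary using (¬_; yes; no; contradiction)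
open import Relation.Nullary.Decidable using (map′)
open import Relation.Unary
  using (Pred; _∈_; _∉_; _⊆_; _≐_; _∩_; _∪_; ∅; ｛_｝; _⊂_; U)

-- Words over a finite alphabet

module _ {n : ℕ} where

  private
    -- Reduction modulo `n` discards the higher digits; `n` is nonzero because `Fin n` has an
    -- element.
    digit-unique : ∀ (i j : Fin n) k l → toℕ i + k * n ≡ toℕ j + l * n → i ≡ j
    digit-unique i j k l eq = toℕ-injective (trans (sym (rem i k))
      (trans (cong (_% n) eq) (rem j l)))
      where
      instance _ = nonZeroIndex i
      rem : ∀ (i : Fin n) k → (toℕ i + k * n) % n ≡ toℕ i
      rem i k = trans ([m+kn]%n≡m%n (toℕ i) k n) (m<n⇒m%n≡m (toℕ<n i))

  module _ {A : Set} (index : A → Fin n) (index-injective : Injective _≡_ _≡_ index) where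

    -- Bijective base-n numeration: the successor keeps leading zeros apart.
    code : List A → ℕ
    code []      = 0
    code (a ∷ w) = ℕ.suc (toℕ (index a) + code w * n)

    code-injective : Injective _≡_ _≡_ code
    code-injective {[]}    {[]}    eq = refl
    code-injective {a ∷ v} {b ∷ w} eq = cong₂ _∷_ (index-injective a≡b)
      (code-injective (*-cancelʳ-≡ (code v) (code w) n {{nonZeroIndex (index a)}}
        (+-cancelˡ-≡ (toℕ (index a)) _ _
          (trans eq′ (cong (λ i → toℕ i + code w * n) (sym a≡b))))))
      where
      eq′ = suc-injective eq
      a≡b = digit-unique (index a) (index b) (code v) (code w) eq′

words-countable : ∀ {A : Set} → Finite (setoid A) →
                  ∃[ c ] Injective {A = List A} {B = ℕ} _≡_ _≡_ c
words-countable {A} (xs , enum) = code index inj , code-injective index inj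
  where
  index : A → Fin (length xs)
  index a = Any.index (enum a)
  inj : Injective _≡_ _≡_ index
  inj = Membership.index-injective (setoid A) (enum _) (enum _)

-- Subsets of a list

subsets : ∀ {A : Set} → List A → List (Pred A 0ℓ)
subsets []       = [ ∅ ]
subsets (x ∷ xs) = map (｛ x ｝ ∪_) (subsets xs) ++ subsets xs

subsets-complete : ExcludedMiddle 0ℓ → ∀ {A : Set} (P : Pred A 0ℓ) xs →
                   Any (P ∩ (List._∈ xs) ≐_) (subsets xs)
subsets-complete em P [] = here ((λ { (_ , ()) }) , λ ())
subsets-complete em P (x ∷ xs) with em {x ∈ P}
... | yes Px = ++⁺ˡ (map⁺ (Any.map
  (λ { (to , from) →
      (λ { (_  , here refl) → inj₁ refl
         ; (Py , there y∈)  → inj₂ (to (Py , y∈)) })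
    , (λ { (inj₁ refl) → Px , here refl
         ; (inj₂ Sy)   → map₂ there (from Sy) }) })
  (subsets-complete em P xs)))
... | no ¬Px = ++⁺ʳ _ (Any.map
  (λ { (to , from) →
      (λ { (Px , here refl) → contradiction Px ¬Px
         ; (Py , there y∈)  → to (Py , y∈) })
    , (λ {_} Sy → map₂ there (from Sy)) })
  (subsets-complete em P xs))

-- Theories of a Tarskian logic

module Tarski {L : Logic} (T : Tarskian L) where
  open Logic L
  open Tarskian T
  open Theory

  cut : ∀ {X Y} → Y ⊆ Cn X → Cn Y ⊆ Cn X
  cut Y⊆CnX α∈ = proj₁ (idempotent _) (monotone Y⊆CnX α∈)

  generated : Pred Fm 0ℓ → Theory L
  generated X = record { carrier = Cn X ; closed = idempotent X }

  infix 4 _⊢_ _⊣⊢_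
  _⊢_ _⊣⊢_ : Fm → Fm → Set
  φ ⊢ ψ  = ψ ∈ Cn ｛ φ ｝
  φ ⊣⊢ ψ = φ ⊢ ψ × ψ ⊢ φ

  ⊢-refl : ∀ {φ} → φ ⊢ φ
  ⊢-refl = extensive _ refl

  apply : ∀ {X φ ψ} → φ ⊢ ψ → φ ∈ Cn X → ψ ∈ Cn X
  apply φ⊢ψ φ∈ = cut (λ { refl → φ∈ }) φ⊢ψ

  -- A theory is closed under interderivability, so it is generated by its members among the
  -- representatives `xs`.
  finitelyManyClasses⇒finite : ExcludedMiddle 0ℓ →
    ∀ xs → (∀ φ → Any (φ ⊣⊢_) xs) → Finite (Θ L)
  finitelyManyClasses⇒finite em xs classes =
    map generated (subsets xs) ,
    λ K → map⁺ (Any.map (generates K) (subsets-complete em (carrier K) xs))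
    where
    generates : ∀ K {S} → carrier K ∩ (List._∈ xs) ≐ S → carrier K ≐ Cn S
    generates K {S} (to , from) = K⊆ , λ φ∈ →
      proj₁ (closed K) (monotone (proj₁ ∘ from) φ∈)
      where
      K⊆ : carrier K ⊆ Cn S
      K⊆ {φ} Kφ with x , x∈xs , φ⊢x , x⊢φ ← List.find (classes φ) =
        apply x⊢φ (extensive S (to (Kx , x∈xs)))
        where Kx = proj₁ (closed K) (apply φ⊢x (extensive _ Kφ))

-- Derivations in a Boolean logic

module Classical {L : Logic} (T : Tarskian L) (B : Boolean L) where
  open Logic L
  open Tarskian T
  open Boolean B
  open Tarski T

  assumption : ∀ {X φ} → φ ∈ Cn (X ∪ ｛ φ ｝)
  assumption = extensive _ (inj₂ refl)

  weaken : ∀ {X Y} → Cn X ⊆ Cn (X ∪ Y)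
  weaken = monotone inj₁

  explosion : ∀ {X φ α} → φ ∈ Cn X → ~ φ ∈ Cn X → α ∈ Cn X
  explosion {X} {φ} φ∈ ~φ∈ =
    cut (λ { (inj₁ refl) → φ∈ ; (inj₂ refl) → ~φ∈ }) (proj₂ (~-join φ) tt)

  cases : ∀ {X φ ψ α} → φ ∨ ψ ∈ Cn X →
          α ∈ Cn (X ∪ ｛ φ ｝) → α ∈ Cn (X ∪ ｛ ψ ｝) → α ∈ Cn X
  cases {X} {φ} {ψ} {α} φ∨ψ∈ l r =
    cut (λ { (inj₁ x) → extensive X x ; (inj₂ refl) → φ∨ψ∈ }) (∨-elim X φ ψ α l r)

  -- Both `φ` and `~ φ` entail the disjunction, so `~-meet` places it in `Cn ∅`.
  excludedMiddle : ∀ {X} φ → φ ∨ ~ φ ∈ Cn X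
  excludedMiddle φ = monotone (λ ()) (proj₁ (~-meet φ)
    (∨-introˡ _ _ _ ⊢-refl , ∨-introʳ _ _ _ ⊢-refl))

  byCases : ∀ {X α} φ → α ∈ Cn (X ∪ ｛ φ ｝) → α ∈ Cn (X ∪ ｛ ~ φ ｝) → α ∈ Cn X
  byCases φ = cases (excludedMiddle φ)

  infixr 7 _∧_
  _∧_ : Fm → Fm → Fm
  φ ∧ ψ = ~ (~ φ ∨ ~ ψ)

  ∧-elimˡ : ∀ {X φ ψ} → φ ∧ ψ ∈ Cn X → φ ∈ Cn X
  ∧-elimˡ {φ = φ} p = byCases φ assumption
    (explosion (∨-introˡ _ _ _ assumption) (weaken p))

  ∧-elimʳ : ∀ {X φ ψ} → φ ∧ ψ ∈ Cn X → ψ ∈ Cn X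
  ∧-elimʳ {ψ = ψ} p = byCases ψ assumption
    (explosion (∨-introʳ _ _ _ assumption) (weaken p))

  ∧-intro : ∀ {X φ ψ} → φ ∈ Cn X → ψ ∈ Cn X → φ ∧ ψ ∈ Cn X
  ∧-intro {X} {φ} {ψ} p q = byCases (~ φ ∨ ~ ψ)
    (cases assumption
      (explosion (weaken (weaken p)) assumption)
      (explosion (weaken (weaken q)) assumption))
    assumption

  ∨-mono : ∀ {φ ψ φ′ ψ′} → φ ⊢ φ′ → ψ ⊢ ψ′ → φ ∨ ψ ⊢ φ′ ∨ ψ′
  ∨-mono p q = cases ⊢-refl
    (∨-introˡ _ _ _ (apply p assumption)) (∨-introʳ _ _ _ (apply q assumption))

  split : ∀ φ c → φ ⊣⊢ (φ ∧ c) ∨ (φ ∧ ~ c)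
  split φ c =
      byCases c (∨-introˡ _ _ _ (∧-intro (weaken ⊢-refl) assumption))
                (∨-introʳ _ _ _ (∧-intro (weaken ⊢-refl) assumption))
    , cases ⊢-refl (∧-elimˡ assumption) (∧-elimˡ assumption)

  -- Small formulae

  Inconsistent : Fm → Set
  Inconsistent φ = ∀ α → φ ⊢ α

  Small : Fm → Set
  Small b = ∃[ xs ] (∀ φ → φ ⊢ b → Any (φ ⊣⊢_) xs)

  -- Each `φ` below `b` is the join of `φ ∧ c` and `φ ∧ ~ c`, so disjunctions of the two kinds of
  -- representatives suffice.
  Small-join : ∀ {b} c → Small (b ∧ c) → Small (b ∧ ~ c) → Small b
  Small-join {b} c (xs , below-c) (ys , below-~c) =
    cartesianProductWith _∨_ xs ys , λ φ φ⊢b →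
      cartesianProductWith⁺ _∨_ (join φ)
        (below-c (φ ∧ c) (meet φ⊢b)) (below-~c (φ ∧ ~ c) (meet φ⊢b))
    where
    meet : ∀ {φ c} → φ ⊢ b → φ ∧ c ⊢ b ∧ c
    meet φ⊢b = ∧-intro (apply φ⊢b (∧-elimˡ ⊢-refl)) (∧-elimʳ ⊢-refl)

    join : ∀ φ {x y} → φ ∧ c ⊣⊢ x → φ ∧ ~ c ⊣⊢ y → φ ⊣⊢ x ∨ y
    join φ (p , p′) (q , q′) =
        apply (∨-mono p q) (proj₁ (split φ c))
      , apply (proj₂ (split φ c)) (∨-mono p′ q′)

  -- At most two classes lie below such a `b`: its own and that of a contradiction.
  trivial⇒Small : ∀ {b} → (∀ φ → φ ⊢ b → b ⊢ φ ⊎ Inconsistent φ) → Small b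
  trivial⇒Small {b} trivial = (b ∷ (b ∧ ~ b) ∷ []) , λ φ φ⊢b →
    [ (λ b⊢φ → here (φ⊢b , b⊢φ))
    , (λ φ⊢⊥ → there (here (φ⊢⊥ _ , explosion (∧-elimˡ ⊢-refl) (∧-elimʳ ⊢-refl))))
    ]′ (trivial φ φ⊢b)

  -- Independence from a strictly descending chain

  Independent : (ℕ → Fm) → Set₁
  Independent e = ∀ {X} j → (∀ {φ} → φ ∈ X → ∃[ i ] i ≢ j × φ ≡ e i) → e j ∉ Cn X

  module Chain (b : ℕ → Fm) (decreasing : ∀ n → b (ℕ.suc n) ⊢ b n)
               (strict : ∀ n → ¬ b n ⊢ b (ℕ.suc n)) where

    antitone : ∀ {m n} → m ≤′ n → b n ⊢ b m
    antitone ≤′-refl           = ⊢-refl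
    antitone (≤′-step {n} m≤n) = apply (antitone m≤n) (decreasing n)

    step : ℕ → Fm
    step n = ~ b n ∨ b (ℕ.suc n)

    gap : ℕ → Pred Fm 0ℓ
    gap j = ｛ b j ｝ ∪ ｛ ~ b (ℕ.suc j) ｝

    -- For `i` below `j`, `b j` entails the consequent of `step i`; for `i` above `j`, `~ b (suc j)`
    -- refutes its antecedent.
    gap⊢step : ∀ {i} j → i ≢ j → step i ∈ Cn (gap j)
    gap⊢step {i} j i≢j with <-cmp i j
    ... | tri< i<j _ _ =
      ∨-introʳ _ _ _ (apply (antitone (≤⇒≤′ i<j)) (extensive _ (inj₁ refl)))
    ... | tri≈ _ i≡j _ = contradiction i≡j i≢j
    ... | tri> _ _ i>j = ∨-introˡ _ _ _ (byCases (b i)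
      (explosion (apply (antitone (≤⇒≤′ i>j)) assumption) (weaken assumption))
      assumption)

    -- Otherwise `b j` and `~ b (suc j)` would jointly yield `b (suc j)`, so `b j` alone would,
    -- against strictness.
    gap⊬step : ∀ j → step j ∉ Cn (gap j)
    gap⊬step j stepⱼ∈ = strict j (byCases (b (ℕ.suc j)) assumption
      (cases stepⱼ∈
        (explosion (weaken (extensive _ (inj₁ refl))) assumption)
        assumption))

    independent : Independent step
    independent {X} j X⊆steps stepⱼ∈ = gap⊬step j (cut gap⊢X stepⱼ∈)
      where
      gap⊢X : X ⊆ Cn (gap j)
      gap⊢X φ∈X with i , i≢j , refl ← X⊆steps φ∈X = gap⊢step j i≢j

  -- Descent through large formulae

  module _ (em : ExcludedMiddle 0ℓ) where

    private
      dne : ∀ {P : Set} → ¬ ¬ P → P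
      dne = em⇒dne em

    Large : Set
    Large = ∃[ b ] ¬ Small b

    intermediate : ((b , _) : Large) → ∃[ c ] c ⊢ b × ¬ b ⊢ c × ¬ Inconsistent c
    intermediate (b , large) = dne λ none → large (trivial⇒Small λ c c⊢b →
      dne λ neither → none
        (c , c⊢b , (λ b⊢c → neither (inj₁ b⊢c)) , λ c⊢⊥ → neither (inj₂ c⊢⊥)))

    descend : (l : Large) → Σ Large λ l′ → proj₁ l′ ⊢ proj₁ l × ¬ proj₁ l ⊢ proj₁ l′
    descend l@(b , large) with c , c⊢b , b⊬c , c⊬⊥ ← intermediate l | em {Small c}
    ... | no c-large = (c , c-large) , c⊢b , b⊬c
    -- Everything below `b ∧ c` is below `c`, so that half is small and the other half must be
    -- large.
    ... | yes (xs , below-c) =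
      (b ∧ ~ c , λ small → large (Small-join c small-b∧c small)) ,
      ∧-elimˡ ⊢-refl ,
      -- If `b` entailed `b ∧ ~ c`, then `c`, being below `b`, would entail `~ c`.
      λ b⊢b∧~c → c⊬⊥ λ _ → explosion ⊢-refl (∧-elimʳ (apply b⊢b∧~c c⊢b))
      where
      small-b∧c : Small (b ∧ c)
      small-b∧c = xs , λ φ φ⊢b∧c → below-c φ (∧-elimʳ φ⊢b∧c)

    independentSequence : ¬ Finite (Θ L) → ∃[ e ] Independent e
    independentSequence infinite = step , independent
      where
      inhabitant : Fm
      inhabitant = dne λ empty →
        infinite (finitelyManyClasses⇒finite em [] λ φ → contradiction φ empty)

      large : ℕ → Large
      -- A tautology lies above every formula, so its smallness would make `Θ L` finite.
      large ℕ.zero    = inhabitant ∨ ~ inhabitant , λ (xs , classes) →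
        infinite (finitelyManyClasses⇒finite em xs λ φ →
          classes φ (excludedMiddle inhabitant))
      large (ℕ.suc n) = proj₁ (descend (large n))

      open Chain (proj₁ ∘ large) (proj₁ ∘ proj₂ ∘ descend ∘ large)
                 (proj₂ ∘ proj₂ ∘ descend ∘ large)

  -- Cantor's diagonal argument

  module Diagonal {e : ℕ → Fm} (independent : Independent e) {W : Set}
                  {code : W → ℕ} (code-injective : Injective _≡_ _≡_ code)
                  (decode : W → Maybe (Theory L)) where

    private
      -- Words that decode to nothing get `∅`, so their `e (code w)` always enters `diagonal`.
      decoded : W → Pred Fm 0ℓ
      decoded w = maybe′ Theory.carrier ∅ (decode w)

    diagonal : Pred Fm 0ℓ
    diagonal φ = ∃[ w ] φ ≡ e (code w) × φ ∉ decoded w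

    diagonal-unrepresented : ∀ w → ¬ decoded w ≐ Cn diagonal
    diagonal-unrepresented w (to , from) =
      e∉decoded (from (extensive _ (w , refl , e∉decoded)))
      where
      e∉decoded : e (code w) ∉ decoded w
      e∉decoded e∈ = independent (code w)
        (λ { (v , refl , e∉) →
             code v , (λ eq → e∉ (subst (λ u → e (code u) ∈ decoded u)
                                        (sym (code-injective eq)) e∈)) , refl })
        (to e∈)

    ¬surjective : ¬ (∀ K → ∃[ w ] Maybe.Any
      (λ K′ → Theory.carrier K′ ≐ Theory.carrier K) (decode w))
    ¬surjective surjective with w , represents ← surjective (generated diagonal) =
      diagonal-unrepresented w (unfold (decode w) represents)
      where
      unfold : ∀ m → Maybe.Any (λ K → Theory.carrier K ≐ Cn diagonal) m →
               maybe′ Theory.carrier ∅ m ≐ Cn diagonal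
      unfold (just _) (Maybe.just eq) = eq

mainTheorem2 : ExcludedMiddle (suc 0ℓ) →
    (L : Logic) → Compendious L →
    (E : Encoding L) → Image L E ⊂ U
mainTheorem2 em L C E = (λ _ → tt) , λ U⊆Image →
  let _ , independent = independentSequence em₀ nonFinitary
      _ , injective = words-countable alphabetFinite
  in Diagonal.¬surjective independent injective decode (λ K → U⊆Image {K} tt)
  where
  open Compendious C
  open Encoding E
  open Classical tarskian boolean
  em₀ : ExcludedMiddle 0ℓ
  em₀ = map′ lower lift em
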